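{- Let $B$ be a barrier on an infinite set $X\subseteq\mathbb{N}$. For every function $f:B\to\mathbb{N}$ there exists a barrier $B'\subseteq B$ such that the image of the restriction of $f$ to $B'$ is different from $\mathbb{N}$.
   Context: $\mathbb{N}$ is the set of natural numbers (including $0$). Subsets of $\mathbb{N}$ are identified with their strictly increasing enumerations; $s\sqsubset Y$ means that $s$ is a proper initial segment of $Y$ as a sequence; $\subset$ is strict set inclusion. A set $B$ of finite subsets of $\mathbb{N}$ is a barrier on an infinite set $X\subseteq\mathbb{N}$ if: (1) $\bigcup B=X$; (2) for all $s,t\in B$, $s\not\subset t$; (3) for every infinite $Y\subseteq X$ there is $s\in B$ with $s\sqsubset Y$. The set $b(B)=\bigcup B$ is called the base of $B$. A family $B'$ is called a barrier if it is a barrier on its base $b(B')$ (in particular $b(B')$ is infinite). -}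

module Defs where

open import Data.List.Base using (List; applyUpTo)
open import Data.List.Membership.Propositional using () renaming (_∈_ to _∈ˡ_)
open import Data.List.Relation.Unary.Linked using (Linked)
open import Data.Nat.Base using (ℕ; _<_)
open import Data.Nat.InfinitelyOften using (Inf)
open import Data.Product.Base using (∃; _×_)
open import Data.Refinement using (Refinement; Refinement-syntax; value; refine)
open import Function.Base using (_∘_)
open import Level using (0ℓ)
open import Relation.Binary.Core using (_Preserves_⟶_)
open import Relation.Binary.PropositionalEquality.Core using (_≡_)
open import Relation.Nullary.Negation.Core using (¬_)
open import Relation.Unary using (Pred; _∈_; _⊆_; _⊂_; _≐_)

-- A finite subset of ℕ is its strictly increasing enumeration, so that _≡_ is
-- extensional equality of finite sets.
FinSet : Set
FinSet = [ xs ∈ List ℕ ∣ Linked _<_ xs ]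

⟦_⟧ : FinSet → Pred ℕ 0ℓ
⟦ s ⟧ n = n ∈ˡ value s

-- The sequence Y is infinite, so every finite initial segment of it is proper.
infix 4 _⊏_
_⊏_ : FinSet → (ℕ → ℕ) → Set
s ⊏ Y = ∃ λ n → value s ≡ applyUpTo Y n

base : Pred FinSet 0ℓ → Pred ℕ 0ℓ
base B n = ∃ λ s → s ∈ B × n ∈ ⟦ s ⟧

record IsBarrierOn (X : Pred ℕ 0ℓ) (B : Pred FinSet 0ℓ) : Set where
  field
    infinite  : Inf X
    covers    : base B ≐ X
    antichain : ∀ s t → s ∈ B → t ∈ B → ¬ (⟦ s ⟧ ⊂ ⟦ t ⟧)
    -- An infinite subset of X is given by its strictly increasing enumeration.
    bars      : ∀ (Y : ℕ → ℕ) → Y Preserves _<_ ⟶ _<_ → (∀ i → Y i ∈ X) →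
                ∃ λ s → s ∈ B × s ⊏ Y

IsBarrier : Pred FinSet 0ℓ → Set
IsBarrier B = IsBarrierOn (base B) B

-- Membership proofs are irrelevant here: a function on Elements B takes one
-- value at each finite set belonging to B, whatever the proof of membership.
Elements : Pred FinSet 0ℓ → Set
Elements B = [ s ∈ FinSet ∣ s ∈ B ]

restrict : ∀ {B B′ : Pred FinSet 0ℓ} → B′ ⊆ B → (Elements B → ℕ) → (Elements B′ → ℕ)
restrict B′⊆B f = f ∘ refine B′⊆B

image : ∀ {A : Set} → (A → ℕ) → Pred ℕ 0ℓ
image g n = ∃ λ x → g x ≡ n

{-# OPTIONS --safe #-}

-- By the Nash-Williams partition theorem, B contains a barrier on which the
-- statement "f s = 0" is either always true or always false; its image omits 1
-- or 0.  For the partition theorem, call a finite sequence s Ramsey if every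
-- infinite Y ⊆ X has an infinite subset Z such that all members of B extending s
-- by elements of Z have the same colour.  Members of B are Ramsey because B is an
-- antichain.  If every s ∷ʳ n is Ramsey then so is s: diagonalise over the first
-- elements n of successively thinner sets, then thin out once more to make the
-- colours obtained for these n agree.  Hence, if [] were not Ramsey, there would
-- be an infinite branch of sequences that are not Ramsey, and it would miss B.
module Submission where

open import Axiom.ExcludedMiddle using (ExcludedMiddle)
open import Data.Bool.Base using (Bool; true; false)
open import Data.List.Base using (List; []; _∷_; _++_; _∷ʳ_; applyUpTo)
open import Data.List.Membership.Propositional using () renaming (_∈_ to _∈ˡ_)
open import Data.List.Membership.Propositional.Properties
  using (∈-++⁺ˡ; ∈-++⁺ʳ)
open import Data.List.Properties using (++-identityʳ; ∷ʳ-++; applyUpTo-∷ʳ)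
open import Data.List.Relation.Unary.All as All using (All; []; _∷_)
open import Data.List.Relation.Unary.All.Properties using (applyUpTo⁺₂)
open import Data.List.Relation.Unary.AllPairs as AllPairs using (AllPairs)
open import Data.List.Relation.Unary.Any using (here)
open import Data.List.Relation.Unary.Any.Properties using (¬Any[])
open import Data.List.Relation.Unary.Linked using (linked?)
open import Data.List.Relation.Unary.Linked.Properties using (Linked⇒AllPairs)
open import Data.Nat.Base
  using (ℕ; zero; suc; _+_; _≤_; _<_; _≤′_; ≤′-refl; ≤′-step; z≤n; s<s; z<s)
open import Data.Nat.InfinitelyOften as InfinitelyOften using (Inf)
open import Data.Nat.Properties
  using (<-trans; <⇒≤; <⇒≱; ≰⇒>; ≤⇒≤′; ≤-refl; ≤-reflexive; ≤-<-trans; <-≤-trans;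
         m≤n⇒m<n∨m≡n; n<1+n; n≮n; +-monoˡ-<; _<?_)
open import Data.Product.Base using (Σ; _×_; ∃; _,_; proj₁; proj₂)
open import Data.Refinement using (value; _,_)
open import Data.Irrelevant using ([_])
open import Data.Sum.Base using (_⊎_; inj₁; inj₂)
open import Data.Unit.Base using (tt)
open import Function.Base using (_∘_; id)
open import Level using (0ℓ)
open import Relation.Binary.Core using (_Preserves_⟶_; Rel)
open import Relation.Binary.PropositionalEquality.Core
  using (_≡_; refl; sym; trans; cong; subst)
open import Relation.Nullary.Decidable using (does; recompute; decidable-stable; dec-true; dec-false)
open import Relation.Nullary.Negation.Core using (¬_; contradiction)
open import Relation.Unary using (Pred; _∈_; _⊆_; _≐_; U; _∪_; ∁)
open import Defs

-- Increasing sequences and sorted lists.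

Increasing : (ℕ → ℕ) → Set
Increasing Y = Y Preserves _<_ ⟶ _<_

step⇒increasing : ∀ {Y} → (∀ n → Y n < Y (suc n)) → Increasing Y
step⇒increasing {Y} step m<n = go (≤⇒≤′ m<n)
  where
  go : ∀ {m n} → suc m ≤′ n → Y m < Y n
  go ≤′-refl       = step _
  go (≤′-step m<n) = <-trans (go m<n) (step _)

increasing⇒reflects-< : ∀ {Y} → Increasing Y → ∀ {m n} → Y m < Y n → m < n
increasing⇒reflects-< {Y} Y↑ {m} {n} Ym<Yn = ≰⇒> λ n≤m → <⇒≱ Ym<Yn (mono n≤m)
  where
  mono : ∀ {i j} → i ≤ j → Y i ≤ Y j
  mono i≤j with m≤n⇒m<n∨m≡n i≤j
  ... | inj₁ i<j  = <⇒≤ (Y↑ i<j)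
  ... | inj₂ refl = ≤-refl

increasing⇒inflationary : ∀ {Y} → Increasing Y → ∀ n → n ≤ Y n
increasing⇒inflationary Y↑ zero    = z≤n
increasing⇒inflationary Y↑ (suc n) =
  ≤-<-trans (increasing⇒inflationary Y↑ n) (Y↑ (n<1+n n))

AllPairs-++⁻ : ∀ {A : Set} {R : Rel A 0ℓ} xs {ys} → AllPairs R (xs ++ ys) →
               All (λ x → All (R x) ys) xs × AllPairs R ys
AllPairs-++⁻ []       rs = [] , rs
AllPairs-++⁻ (x ∷ xs) (r AllPairs.∷ rs) with AllPairs-++⁻ xs rs
... | rxy , ry = All.tabulate (λ y∈ys → All.lookup r (∈-++⁺ʳ xs y∈ys)) ∷ rxy , ry

-- A finite set carries its sortedness proof irrelevantly; decidability of `_<_` on ℕ makes it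
-- available again.
sorted : ∀ (u : FinSet) → AllPairs _<_ (value u)
sorted (xs , [ p ]) = Linked⇒AllPairs <-trans (recompute (linked? _<?_ xs) p)

sorted-suffix : ∀ (u : FinSet) s {n t} → value u ≡ s ++ n ∷ t → All (n <_) t
sorted-suffix u s eq =
  AllPairs.head (proj₂ (AllPairs-++⁻ s (subst (AllPairs _<_) eq (sorted u))))

-- Infinite sets and the pigeonhole principle.

module _ (em : ExcludedMiddle 0ℓ) where

  infinite⇒enumerable : ∀ {P : Pred ℕ 0ℓ} → Inf P →
                        ∃ λ Y → Increasing Y × (∀ i → Y i ∈ P)
  infinite⇒enumerable {P} inf = Y , step⇒increasing Y-step , Y∈P
    where
    next : ∀ i → ∃ λ j → i ≤ j × j ∈ P
    next i = decidable-stable em λ ¬∃ → inf (i , λ j i≤j Pj → ¬∃ (j , i≤j , Pj))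

    Y : ℕ → ℕ
    Y zero    = proj₁ (next 0)
    Y (suc n) = proj₁ (next (suc (Y n)))

    Y-step : ∀ n → Y n < Y (suc n)
    Y-step n = proj₁ (proj₂ (next (suc (Y n))))

    Y∈P : ∀ n → Y n ∈ P
    Y∈P zero    = proj₂ (proj₂ (next 0))
    Y∈P (suc n) = proj₂ (proj₂ (next (suc (Y n))))

  pigeonhole : ∀ (c : ℕ → Bool) →
               ∃ λ b → ∃ λ φ → Increasing φ × (∀ i → c (φ i) ≡ b)
  pigeonhole c with decidable-stable em (InfinitelyOften.commutes-with-∪ all-infinite)
    where
    all-infinite : Inf ((λ n → c n ≡ true) ∪ (λ n → c n ≡ false))
    all-infinite (i , none) with c i in eq
    ... | true  = none i ≤-refl (inj₁ eq)
    ... | false = none i ≤-refl (inj₂ eq)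
  ... | inj₁ inf = true  , infinite⇒enumerable inf
  ... | inj₂ inf = false , infinite⇒enumerable inf

  module _ {X : Pred ℕ 0ℓ} {B : Pred FinSet 0ℓ} (barrier : IsBarrierOn X B) where
    open IsBarrierOn barrier

    record InfiniteSubset : Set where
      field
        enum       : ℕ → ℕ
        increasing : Increasing enum
        within     : ∀ i → enum i ∈ X

    open InfiniteSubset

    tail : InfiniteSubset → InfiniteSubset
    tail Y = record
      { enum       = enum Y ∘ suc
      ; increasing = increasing Y ∘ s<s
      ; within     = within Y ∘ suc
      }

    -- A first extra entry `n` would exceed all of `v`, making `v` a strict subset of `u` against
    -- the antichain condition.
    no-proper-extension : ∀ {v u} → v ∈ B → u ∈ B → ∀ t → value u ≡ value v ++ t → t ≡ []
    no-proper-extension v∈B u∈B [] eq = refl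
    no-proper-extension {v} {u} v∈B u∈B (n ∷ t) eq =
      contradiction (v⊆u , λ u⊆v → n∉v (u⊆v n∈u)) (antichain v u v∈B u∈B)
      where
      v⊆u : ⟦ v ⟧ ⊆ ⟦ u ⟧
      v⊆u x∈v = subst (_ ∈ˡ_) (sym eq) (∈-++⁺ˡ x∈v)

      n∈u : n ∈ ⟦ u ⟧
      n∈u = subst (n ∈ˡ_) (sym eq) (∈-++⁺ʳ (value v) (here refl))

      n∉v : ¬ n ∈ ⟦ v ⟧
      n∉v n∈v = n≮n n (All.head (All.lookup
        (proj₁ (AllPairs-++⁻ (value v) (subst (AllPairs _<_) eq (sorted u)))) n∈v))

    -- Ramsey sequences for a colouring.

    module _ (colour : FinSet → Bool) where

      -- Only the added part `t` must lie in `Z`, so `Z` can shrink while `s` stays fixed.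
      Homogeneous : Bool → List ℕ → InfiniteSubset → Set
      Homogeneous c s Z = ∀ u → u ∈ B → ∀ t → value u ≡ s ++ t →
                          All (image (enum Z)) t → colour u ≡ c

      Ramsey : List ℕ → Set
      Ramsey s = ∀ Y → ∃ λ Z → image (enum Z) ⊆ image (enum Y) ×
                 ∃ λ c → Homogeneous c s Z

      ramsey-leaf : ∀ v → v ∈ B → Ramsey (value v)
      ramsey-leaf v v∈B Y = Y , id , colour v , same
        where
        same : Homogeneous (colour v) (value v) Y
        same u u∈B t eq _ with no-proper-extension {v} {u} v∈B u∈B t eq
        -- With `t` empty the two lists agree, and irrelevance of sortedness proofs then identifies
        -- `u` with `v`.
        same (_ , _) u∈B .[] eq _ | refl with trans eq (++-identityʳ (value v))
        ... | refl = refl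

      ramsey-node : ∀ s → ¬ (∃ λ v → v ∈ B × value v ≡ s) →
                    (∀ n → n ∈ X → Ramsey (s ∷ʳ n)) → Ramsey s
      ramsey-node s s∉B ramsey Y = Z , Z⊆Y , c , homogeneous
        where
        -- The first element of `W` extends `s`; the new set is taken inside the tail so that it
        -- lies strictly above that element.
        thin : ∀ W → ∃ λ Z → image (enum Z) ⊆ image (enum (tail W)) ×
               ∃ λ c → Homogeneous c (s ∷ʳ enum W 0) Z
        thin W = ramsey (enum W 0) (within W 0) (tail W)

        stage : ℕ → InfiniteSubset
        stage zero    = Y
        stage (suc i) = proj₁ (thin (stage i))

        stage-colour : ℕ → Bool
        stage-colour i = proj₁ (proj₂ (proj₂ (thin (stage i))))

        stage-antitone : ∀ {i j} → i ≤′ j → image (enum (stage j)) ⊆ image (enum (stage i))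
        stage-antitone ≤′-refl = id
        stage-antitone (≤′-step {j} i≤j) x∈ with proj₁ (proj₂ (thin (stage j))) x∈
        ... | k , eq = stage-antitone i≤j (suc k , eq)

        diag : ℕ → ℕ
        diag i = enum (stage i) 0

        diag-increasing : Increasing diag
        diag-increasing = step⇒increasing λ i →
          let k , eq = proj₁ (proj₂ (thin (stage i))) (0 , refl)
          in <-≤-trans (increasing (stage i) z<s) (≤-reflexive eq)

        diag∈stage : ∀ {i j} → i ≤ j → diag j ∈ image (enum (stage i))
        diag∈stage i≤j = stage-antitone (≤⇒≤′ i≤j) (0 , refl)

        constant = pigeonhole stage-colour

        c : Bool
        c = proj₁ constant

        φ : ℕ → ℕ
        φ = proj₁ (proj₂ constant)

        φ-increasing : Increasing φ
        φ-increasing = proj₁ (proj₂ (proj₂ constant))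

        Z : InfiniteSubset
        Z = record
          { enum       = diag ∘ φ
          ; increasing = diag-increasing ∘ φ-increasing
          ; within     = λ i → within (stage (φ i)) 0
          }

        Z⊆Y : image (enum Z) ⊆ image (enum Y)
        Z⊆Y (i , refl) = diag∈stage {0} {φ i} z≤n

        homogeneous : Homogeneous c s Z
        -- No stage controls the colour of `s` itself; this is where `s` must not belong to `B`.
        homogeneous u u∈B [] eq _ = contradiction (u , u∈B , trans eq (++-identityʳ s)) s∉B
        -- Here `n` is `diag (φ j)`. The entries of `t` are later diagonal elements, hence lie in
        -- `stage (suc (φ j))`, which is homogeneous for `s ∷ʳ n` with colour `c`.
        homogeneous u u∈B (n ∷ t) eq ((j , refl) ∷ t⊆Z) =
          trans
            (proj₂ (proj₂ (proj₂ (thin (stage (φ j))))) u u∈B t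
              (trans eq (sym (∷ʳ-++ s n t)))
              (All.zipWith later (sorted-suffix u s eq , t⊆Z)))
            (proj₂ (proj₂ (proj₂ constant)) j)
          where
          later : ∀ {m} → n < m × m ∈ image (enum Z) → m ∈ image (enum (stage (suc (φ j))))
          later (n<m , k , refl) =
            diag∈stage {suc (φ j)} {φ k} (increasing⇒reflects-< diag-increasing n<m)

      -- Otherwise every set is vacuously homogeneous for `s`. Since members of `B` are sorted, this
      -- forces the branch below to increase.
      non-ramsey-extends : ∀ s → ¬ Ramsey s → ∃ λ u → u ∈ B × ∃ λ t → value u ≡ s ++ t
      non-ramsey-extends s ¬r = decidable-stable em λ ¬∃ →
        ¬r λ Y → Y , id , true , λ u u∈B t eq _ → contradiction (u , u∈B , t , eq) ¬∃

      non-ramsey-child : ∀ s → ¬ Ramsey s → ∃ λ n → n ∈ X × ¬ Ramsey (s ∷ʳ n)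
      non-ramsey-child s ¬r = decidable-stable em λ ¬∃ →
        ¬r (ramsey-node s
          (λ { (v , v∈B , refl) → ¬r (ramsey-leaf v v∈B) })
          (λ n n∈X → decidable-stable em λ ¬rn → ¬∃ (n , n∈X , ¬rn)))

      ramsey-[] : Ramsey []
      ramsey-[] = decidable-stable em ¬¬ramsey
        where
        ¬¬ramsey : ¬ ¬ Ramsey []
        ¬¬ramsey ¬ramsey = missed (bars Y (step⇒increasing Y-step) Y∈X)
          where
          branch : ℕ → ∃ λ s → ¬ Ramsey s
          child  : ∀ n → ∃ λ m → m ∈ X × ¬ Ramsey (proj₁ (branch n) ∷ʳ m)
          branch zero    = [] , ¬ramsey
          branch (suc n) = _ , proj₂ (proj₂ (child n))
          child n = non-ramsey-child _ (proj₂ (branch n))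

          Y : ℕ → ℕ
          Y n = proj₁ (child n)

          Y∈X : ∀ n → Y n ∈ X
          Y∈X n = proj₁ (proj₂ (child n))

          branch≡Y : ∀ n → proj₁ (branch n) ≡ applyUpTo Y n
          branch≡Y zero    = refl
          branch≡Y (suc n) = trans (cong (_∷ʳ Y n) (branch≡Y n)) (applyUpTo-∷ʳ Y n)

          Y-step : ∀ n → Y n < Y (suc n)
          Y-step n =
            let s = proj₁ (branch n)
                -- Length `2 + n` is the first at which both `Y n` and `Y (suc n)` occur in the
                -- branch.
                u , _ , t , eq = non-ramsey-extends _ (proj₂ (branch (2 + n)))
                eq′ = trans eq (trans (∷ʳ-++ (s ∷ʳ Y n) _ t) (∷ʳ-++ s _ _))
            in All.head (sorted-suffix u s eq′)

          missed : ¬ (∃ λ s → s ∈ B × s ⊏ Y)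
          missed (s , s∈B , n , eq) = proj₂ (branch n)
            (subst Ramsey (trans eq (sym (branch≡Y n))) (ramsey-leaf s s∈B))

    -- Restricting a barrier to an infinite set.

    _∣_ : Pred FinSet 0ℓ → InfiniteSubset → Pred FinSet 0ℓ
    (C ∣ Z) s = s ∈ C × All (image (enum Z)) (value s)

    -- The infinite set `X` has an element, and the member of `B` containing it would strictly
    -- include the empty set.
    []∉B : ∀ s → s ∈ B → ¬ value s ≡ []
    []∉B s s∈B refl = InfinitelyOften.witness infinite λ (n , n∈X) →
      let t , t∈B , n∈t = proj₂ covers n∈X
      in antichain s t s∈B t∈B ((λ ()) , λ t⊆s → ¬Any[] (t⊆s n∈t))

    ∣-isBarrier : ∀ Z → IsBarrier (B ∣ Z)
    ∣-isBarrier Z = record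
      { infinite  = λ (i , none) → none (enum Z i) (increasing⇒inflationary (increasing Z) i)
                                        (Z⊆base i)
      ; covers    = id , id
      ; antichain = λ s t (s∈B , _) (t∈B , _) → antichain s t s∈B t∈B
      ; bars      = bars′
      }
      where
      Z⊆base : ∀ i → enum Z i ∈ base (B ∣ Z)
      -- The barrier is applied to `Z` from index `i` on: the segment found is nonempty, so it
      -- starts with `enum Z i`.
      Z⊆base i with bars (λ j → enum Z (j + i)) (increasing Z ∘ +-monoˡ-< i)
                         (λ j → within Z (j + i))
      ... | s , s∈B , zero  , eq = contradiction eq ([]∉B s s∈B)
      ... | s , s∈B , suc n , eq =
        s , (s∈B , subst (All _) (sym eq) (applyUpTo⁺₂ _ (suc n) λ j → j + i , refl)) ,
        subst (enum Z i ∈ˡ_) (sym eq) (here refl)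

      base⊆Z : base (B ∣ Z) ⊆ image (enum Z)
      base⊆Z (s , (_ , s⊆Z) , n∈s) = All.lookup s⊆Z n∈s

      Z⊆X : image (enum Z) ⊆ X
      Z⊆X (j , refl) = within Z j

      bars′ : ∀ Y → Increasing Y → (∀ i → Y i ∈ base (B ∣ Z)) →
              ∃ λ s → s ∈ (B ∣ Z) × s ⊏ Y
      bars′ Y Y↑ Y∈ with bars Y Y↑ (Z⊆X ∘ base⊆Z ∘ Y∈)
      ... | s , s∈B , n , eq =
        s , (s∈B , subst (All _) (sym eq) (applyUpTo⁺₂ Y n (base⊆Z ∘ Y∈))) , n , eq

    -- Colour by membership in `A`: homogeneity for `[]` concerns every member of `B` with all
    -- entries in `Z`.
    nash-williams : ∀ (A : Pred FinSet 0ℓ) →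
                    ∃ λ Z → (B ∣ Z) ⊆ A ⊎ (B ∣ Z) ⊆ ∁ A
    nash-williams A =
      let Y , Y↑ , Y∈X = infinite⇒enumerable infinite
          Z , _ , c , hom = ramsey-[] colour
                              (record { enum = Y ; increasing = Y↑ ; within = Y∈X })
      in Z , split c λ u (u∈B , u⊆Z) → hom u u∈B (value u) refl u⊆Z
      where
      colour : FinSet → Bool
      colour u = does (em {A u})

      split : ∀ {C : Pred FinSet 0ℓ} c → (∀ u → u ∈ C → colour u ≡ c) → C ⊆ A ⊎ C ⊆ ∁ A
      split true  mono = inj₁ λ u∈C → decidable-stable em λ ¬Au →
        contradiction (trans (sym (mono _ u∈C)) (dec-false em ¬Au)) λ ()
      split false mono = inj₂ λ u∈C Au →
        contradiction (trans (sym (mono _ u∈C)) (dec-true em Au)) λ ()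

mainTheorem2 : ExcludedMiddle 0ℓ →
    ∀ (X : Pred ℕ 0ℓ) (B : Pred FinSet 0ℓ) → IsBarrierOn X B →
    ∀ (f : Elements B → ℕ) →
    ∃ λ (B′ : Pred FinSet 0ℓ) → Σ (B′ ⊆ B) λ B′⊆B →
    IsBarrier B′ × ¬ (image (restrict {B} {B′} B′⊆B f) ≐ U)
mainTheorem2 em X B barrier f =
  let Z , uniform = nash-williams em barrier Zero
  in _ , proj₁ , ∣-isBarrier em barrier Z , λ (_ , onto) → not-onto proj₁ uniform onto
  where
  -- Quantifying over `x` turns a condition on `f` into a predicate on all finite sets, as the
  -- partition theorem requires.
  Zero : Pred FinSet 0ℓ
  Zero u = ∃ λ x → value x ≡ u × f x ≡ 0

  not-onto : ∀ {B′ : Pred FinSet 0ℓ} (B′⊆B : B′ ⊆ B) → B′ ⊆ Zero ⊎ B′ ⊆ ∁ Zero →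
             ¬ U ⊆ image (restrict {B} {B′} B′⊆B f)
  not-onto B′⊆B (inj₁ B′⊆Zero) onto with onto {1} tt
  -- Membership in `Elements` is irrelevant, so excluded middle recovers a usable proof; `f` then
  -- takes both values 0 and 1 at `u`.
  ... | (u , [ u∈B′ ]) , fu≡1 with B′⊆Zero (recompute em u∈B′)
  ... | _ , refl , fu≡0 = contradiction (trans (sym fu≡0) fu≡1) λ ()
  not-onto B′⊆B (inj₂ B′⊆∁Zero) onto with onto {0} tt
  ... | (u , [ u∈B′ ]) , fu≡0 = B′⊆∁Zero (recompute em u∈B′) (_ , refl , fu≡0)
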